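{- There exists a positive constant $c$ such that for every integer $k\geq 2$ and every graph $G$ with $\operatorname{tw}(G)\geq ck^4\log^{5/2}(k)$, we have $\operatorname{tw}(G\times K_2)\geq k$.
   Context: All graphs are finite and simple. $\operatorname{tw}$ denotes treewidth. The direct product $G\times K_2$ has vertex set $V(G)\times V(K_2)$, with $(a,v)(b,u)$ an edge iff $ab\in E(G)$ and $uv\in E(K_2)$ (i.e. it is the bipartite double cover of $G$). -}

module Defs where

open import Data.Nat using (ℕ; zero; suc; _+_; _*_; _≤_)
open import Data.Bool using (Bool; true; false; _∧_)
open import Data.Bool.Properties using (∧-comm)
open import Data.Fin using (Fin; zero; suc; inject₁; fromℕ; remQuot)
open import Data.Fin.Subset using (Subset; _∈_; ∣_∣)
open import Data.Product using (Σ; ∃; _×_; _,_; proj₁; proj₂)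
open import Data.Unit using (⊤)
open import Function.Definitions using (Injective)
open import Relation.Nullary using (¬_)
open import Relation.Binary.PropositionalEquality using (_≡_; refl; cong₂; trans)

record Graph (n : ℕ) : Set where
  field
    adj    : Fin n → Fin n → Bool
    sym    : ∀ i j → adj i j ≡ adj j i
    irrefl : ∀ i → adj i i ≡ false
open Graph public

Adj : ∀ {n} → Graph n → Fin n → Fin n → Set
Adj G i j = adj G i j ≡ true

data Walk {n} (G : Graph n) (P : Fin n → Set) : Fin n → Fin n → Set where
  here : ∀ {i} → P i → Walk G P i i
  step : ∀ {i j k} → P i → Adj G i j → Walk G P j k → Walk G P i k

Connected : ∀ {n} → Graph n → Set
Connected {n} G = ∀ (i j : Fin n) → Walk G (λ _ → ⊤) i j

IsCycle : ∀ {n} → Graph n → (l : ℕ) → (Fin (suc (suc (suc l))) → Fin n) → Set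
IsCycle G l f =
  Injective _≡_ _≡_ f
  × (∀ (i : Fin (suc (suc l))) → Adj G (f (inject₁ i)) (f (suc i)))
  × Adj G (f (fromℕ (suc (suc l)))) (f zero)

Acyclic : ∀ {n} → Graph n → Set
Acyclic G = ∀ l f → ¬ IsCycle G l f

IsTree : ∀ {n} → Graph n → Set
IsTree G = Connected G × Acyclic G

record TreeDecomposition {n} (G : Graph n) : Set where
  field
    m       : ℕ
    T       : Graph (suc m)
    isTree  : IsTree T
    bag     : Fin (suc m) → Subset n
    coverV  : ∀ v → ∃ λ t → v ∈ bag t
    coverE  : ∀ a b → Adj G a b → ∃ λ t → (a ∈ bag t × b ∈ bag t)
    subtree : ∀ v s t → v ∈ bag s → v ∈ bag t → Walk T (λ x → v ∈ bag x) s t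
open TreeDecomposition public

-- tw(G) ≥ t : every tree decomposition has width ≥ t,
-- i.e. some bag of size ≥ t + 1.
TwAtLeast : ∀ {n} → Graph n → ℕ → Set
TwAtLeast G t = ∀ (D : TreeDecomposition G) → ∃ λ x → suc t ≤ ∣ bag D x ∣

k2adj : Fin 2 → Fin 2 → Bool
k2adj zero zero = false
k2adj zero (suc zero) = true
k2adj (suc zero) zero = true
k2adj (suc zero) (suc zero) = false

k2sym : ∀ u v → k2adj u v ≡ k2adj v u
k2sym zero zero = refl
k2sym zero (suc zero) = refl
k2sym (suc zero) zero = refl
k2sym (suc zero) (suc zero) = refl

_×K₂ : ∀ {n} → Graph n → Graph (n * 2)
_×K₂ {n} G = record
  { adj = λ x y → adj G (proj₁ (remQuot {n} 2 x)) (proj₁ (remQuot {n} 2 y))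
                 ∧ k2adj (proj₂ (remQuot {n} 2 x)) (proj₂ (remQuot {n} 2 y))
  ; sym = λ x y → cong₂ _∧_ (sym G _ _) (k2sym _ _)
  ; irrefl = λ x → cong₂ _∧_ (irrefl G _) refl
  }

{-# OPTIONS --safe #-}
-- A tree decomposition of G × K₂ with bags of size at most k yields one of G with
-- bags of size at most 2k.  Root the tree.  Each vertex v of G has two lifts, whose
-- subtrees have tops τ₀ and τ₁.  If the tops are comparable, represent v by the lift
-- with the higher top and place v there; otherwise the paths to τ₀ and τ₁ fork at a
-- node y through distinct children, and v is placed at y and represented by the lift
-- in the smaller child.  The vertices forked at y induce a bipartite graph, which the
-- representing lifts embed into G × K₂, so the given decomposition restricts to it;
-- every other neighbour of such a vertex has its representing lift in the bag of y.
-- Hanging a copy of the tree below every node y for the vertices forked at y, and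
-- adding the vertices represented in the bag of y to all bags of that copy, gives
-- the decomposition of G.
module Submission where

open import Defs
open import Data.Nat using (ℕ; zero; suc; _+_; _*_; _^_; _≤_; _<_; _≥_; z≤n; s≤s; s≤s⁻¹; _≤?_; >-nonZero)
import Data.Nat.Properties as ℕ
open import Data.Nat.Induction using (<-wellFounded)
open import Data.Nat.Logarithm using (⌊log₂_⌋; ⌊log₂⌋-mono-≤)
open import Data.Nat.Tactic.RingSolver using (solve-∀)
open import Data.Bool using (true; false; _∧_; _∨_)
open import Data.Bool.Properties using (∨-comm) renaming (_≟_ to _≟ᵇ_)
open import Data.Empty using (⊥; ⊥-elim)
open import Data.Unit using (⊤; tt)
open import Data.Fin using (Fin; zero; suc; inject₁; fromℕ; toℕ; combine; remQuot; opposite) renaming (_<_ to _<ᶠ_)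
import Data.Fin.Properties as Fin
open import Data.Fin.Relation.Unary.Top using (view; ‵fromℕ; ‵inject₁)
open import Data.Fin.Subset using (Subset; _∈_; ∣_∣; _∪_; inside; outside)
open import Data.Fin.Subset.Properties using (_∈?_; x∈p∪q⁺; drop-there; ∣p∣≤∣x∷p∣)
open import Data.Product using (Σ; ∃; _×_; _,_; proj₁; proj₂)
open import Data.Sum using (_⊎_; inj₁; inj₂)
open import Data.Vec using ([]; _∷_; tabulate; here; there)
open import Data.Vec.Properties using (lookup⇒[]=; []=⇒lookup; lookup∘tabulate)
open import Function using (_∘_)
open import Function.Definitions using (Injective)
open import Induction.WellFounded using (Acc; acc)
open import Relation.Binary.Definitions using (tri<; tri≈; tri>)
open import Relation.Binary.PropositionalEquality using (_≡_; _≢_; refl; trans; cong; cong₂; subst; subst₂) renaming (sym to ≡-sym)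
open import Relation.Nullary using (¬_; Dec; yes; no; does; contradiction)
open import Relation.Nullary.Decidable using (_×-dec_; dec-true)
open import Relation.Unary using (Decidable)

-- Walks and rootings

infixr 5 _++ʷ_

_++ʷ_ : ∀ {n} {G : Graph n} {P i j k} → Walk G P i j → Walk G P j k → Walk G P i k
here _     ++ʷ w′ = w′
step p a w ++ʷ w′ = step p a (w ++ʷ w′)

walk-start : ∀ {n} {G : Graph n} {P i j} → Walk G P i j → P i
walk-start (here p)     = p
walk-start (step p _ _) = p

Adj-sym : ∀ {n} (G : Graph n) {i j} → Adj G i j → Adj G j i
Adj-sym G a = trans (Graph.sym G _ _) a

Adj⇒≢ : ∀ {n} (G : Graph n) {i j} → Adj G i j → i ≢ j
Adj⇒≢ G {i} a refl with trans (≡-sym a) (irrefl G i)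
... | ()

reverseʷ : ∀ {n} {G : Graph n} {P i j} → Walk G P i j → Walk G P j i
reverseʷ (here p)             = here p
reverseʷ {G = G} (step p a w) = reverseʷ w ++ʷ step (walk-start w) (Adj-sym G a) (here p)

-- `depth` is any rank that decreases towards the root, so that a comb of trees can be ranked by a
-- sum of depths. The value of `parent` at `root` is arbitrary.
record Rooting (N : ℕ) : Set where
  field
    root   : Fin N
    parent : Fin N → Fin N
    depth  : Fin N → ℕ
    depth-parent : ∀ {s} → s ≢ root → depth (parent s) < depth s

  climb : (P : Fin N → Set) → P root → (∀ {s} → s ≢ root → P (parent s) → P s) → ∀ s → P s
  climb P base up s = go s (<-wellFounded (depth s))
    where
    go : ∀ s → Acc _<_ (depth s) → P s
    go s (acc rec) with s Fin.≟ root
    ... | yes refl = base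
    ... | no s≢    = up s≢ (go (parent s) (rec (depth-parent s≢)))

-- Rooted trees as graphs

module _ {N : ℕ} (R : Rooting N) where
  open Rooting R

  ParentOf : Fin N → Fin N → Set
  ParentOf x s = s ≢ root × parent s ≡ x

  parentOf? : ∀ x s → Dec (ParentOf x s)
  parentOf? x s with s Fin.≟ root
  ... | yes s≡ = no λ q → proj₁ q s≡
  ... | no s≢ with parent s Fin.≟ x
  ...   | yes e = yes (s≢ , e)
  ...   | no ¬e = no λ q → ¬e (proj₂ q)

  ParentOf-irrefl : ∀ {s} → ¬ ParentOf s s
  ParentOf-irrefl (s≢ , e) = ℕ.<-irrefl (cong depth e) (depth-parent s≢)

  rootedGraph : Graph N
  rootedGraph = record
    { adj    = λ i j → does (parentOf? i j) ∨ does (parentOf? j i)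
    ; sym    = λ i j → ∨-comm (does (parentOf? i j)) _
    ; irrefl = irr
    }
    where
    irr : ∀ i → does (parentOf? i i) ∨ does (parentOf? i i) ≡ false
    irr i with parentOf? i i
    ... | yes q = contradiction q ParentOf-irrefl
    ... | no _  = refl

  adj-parent : ∀ {s} → s ≢ root → Adj rootedGraph s (parent s)
  adj-parent {s} s≢ with parentOf? (parent s) s
  ... | no ¬q = contradiction (s≢ , refl) ¬q
  ... | yes _ with does (parentOf? s (parent s))
  ...   | true  = refl
  ...   | false = refl

  adj⇒parentOf : ∀ {i j} → Adj rootedGraph i j → ParentOf i j ⊎ ParentOf j i
  adj⇒parentOf {i} {j} a with parentOf? i j | parentOf? j i
  ... | yes q | _     = inj₁ q
  ... | no _  | yes q = inj₂ q
  adj⇒parentOf () | no _  | no _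

  rooted-connected : Connected rootedGraph
  rooted-connected i j = toRoot i ++ʷ reverseʷ (toRoot j)
    where
    toRoot : ∀ s → Walk rootedGraph (λ _ → ⊤) s root
    toRoot = climb _ (here tt) (λ s≢ w → step tt (adj-parent s≢) w)

  adj-lower : ∀ {i j} → Adj rootedGraph i j → depth j ≤ depth i → parent i ≡ j
  adj-lower {i} {j} a j≤i with adj⇒parentOf {i} {j} a
  ... | inj₁ (j≢ , refl) = contradiction (depth-parent j≢) (ℕ.≤⇒≯ j≤i)
  ... | inj₂ (_ , e)     = e

argmax : ∀ {n} (f : Fin (suc n) → ℕ) → ∃ λ i → ∀ j → f j ≤ f i
argmax {zero}  f = zero , λ { zero → ℕ.≤-refl }
argmax {suc n} f with argmax (f ∘ suc)
... | i , max with f zero ≤? f (suc i)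
...   | yes f0≤ = suc i , λ { zero → f0≤ ; (suc j) → max j }
...   | no f0≰  = zero , λ { zero → ℕ.≤-refl ; (suc j) → ℕ.≤-trans (max j) (ℕ.≰⇒≥ f0≰) }

-- The neighbours are the cyclic predecessor and successor. They differ because `IsCycle` asks for
-- at least three vertices.
cycle-neighbours : ∀ {n} (G : Graph n) {l f} → IsCycle G l f → ∀ i →
  ∃ λ j → ∃ λ k → j ≢ k × Adj G (f i) (f j) × Adj G (f i) (f k)
cycle-neighbours G (_ , next , last) zero =
  suc zero , fromℕ _ , (λ ()) , next zero , Adj-sym G last
cycle-neighbours G (_ , next , last) (suc i) with view i
... | ‵fromℕ     = inject₁ (fromℕ _) , zero , (λ ()) , Adj-sym G (next (fromℕ _)) , last
... | ‵inject₁ j = inject₁ (inject₁ j) , suc (suc j) , distinct , Adj-sym G (next (inject₁ j)) , next (suc j)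
  where
  distinct : inject₁ (inject₁ j) ≢ suc (suc j)
  distinct e = ℕ.<⇒≢ (ℕ.m≤n⇒m≤1+n (ℕ.n<1+n (toℕ j)))
    (trans (≡-sym (trans (Fin.toℕ-inject₁ (inject₁ j)) (Fin.toℕ-inject₁ j))) (cong toℕ e))

-- Both neighbours of a deepest vertex of a cycle would be its parent.
rooted-acyclic : ∀ {N} (R : Rooting N) → Acyclic (rootedGraph R)
rooted-acyclic R l f cyc@(inj , _) with argmax (Rooting.depth R ∘ f)
... | i , max with cycle-neighbours (rootedGraph R) cyc i
...   | j , k , j≢k , ij , ik =
  j≢k (inj (trans (≡-sym (adj-lower R {f i} {f j} ij (max j))) (adj-lower R {f i} {f k} ik (max k))))

-- Breadth-first rooting of a tree

data Path {n} (G : Graph n) : Fin n → Fin n → ℕ → Set where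
  [_] : ∀ a → Path G a a 0
  _∷_ : ∀ {a b c l} → Adj G a b → Path G b c l → Path G a c (suc l)

module _ {n : ℕ} {G : Graph n} where

  vertex : ∀ {a b l} → Path G a b l → Fin (suc l) → Fin n
  vertex {a} _ zero    = a
  vertex (_ ∷ π) (suc i) = vertex π i

  _∷ʳ_ : ∀ {a b c l} → Path G a b l → Adj G b c → Path G a c (suc l)
  [ a ]   ∷ʳ e = e ∷ [ _ ]
  (d ∷ π) ∷ʳ e = d ∷ (π ∷ʳ e)

  vertex-last : ∀ {a b l} (π : Path G a b l) → vertex π (fromℕ l) ≡ b
  vertex-last [ a ]   = refl
  vertex-last (_ ∷ π) = vertex-last π

  vertex-adj : ∀ {a b l} (π : Path G a b l) i → Adj G (vertex π (inject₁ i)) (vertex π (suc i))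
  vertex-adj (e ∷ π) zero    = e
  vertex-adj (_ ∷ π) (suc i) = vertex-adj π i

  vertex-∷ʳ-inject₁ : ∀ {a b c l} (π : Path G a b l) (e : Adj G b c) i →
    vertex (π ∷ʳ e) (inject₁ i) ≡ vertex π i
  vertex-∷ʳ-inject₁ [ a ]   e zero    = refl
  vertex-∷ʳ-inject₁ (_ ∷ π) e zero    = refl
  vertex-∷ʳ-inject₁ (_ ∷ π) e (suc i) = vertex-∷ʳ-inject₁ π e i

  Simple : ∀ {a b l} → Path G a b l → Set
  Simple π = Injective _≡_ _≡_ (vertex π)

  ∷-simple : ∀ {a b c l} (e : Adj G a b) {π : Path G b c l} →
    Simple π → (∀ i → vertex π i ≢ a) → Simple (e ∷ π)
  ∷-simple e inj fresh {zero}  {zero}  _ = refl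
  ∷-simple e inj fresh {zero}  {suc j} q = contradiction (≡-sym q) (fresh j)
  ∷-simple e inj fresh {suc i} {zero}  q = contradiction q (fresh i)
  ∷-simple e inj fresh {suc i} {suc j} q = cong suc (inj q)

  ∷ʳ-simple : ∀ {a b c l} {π : Path G a b l} (e : Adj G b c) →
    Simple π → (∀ i → vertex π i ≢ c) → Simple (π ∷ʳ e)
  ∷ʳ-simple {π = π} e inj fresh {i} {j} q with view i | view j
  ... | ‵fromℕ     | ‵fromℕ     = refl
  ... | ‵fromℕ     | ‵inject₁ j′ = contradiction
    (trans (≡-sym (vertex-∷ʳ-inject₁ π e j′)) (trans (≡-sym q) (vertex-last (π ∷ʳ e)))) (fresh j′)
  ... | ‵inject₁ i′ | ‵fromℕ     = contradiction
    (trans (≡-sym (vertex-∷ʳ-inject₁ π e i′)) (trans q (vertex-last (π ∷ʳ e)))) (fresh i′)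
  ... | ‵inject₁ i′ | ‵inject₁ j′ = cong inject₁ (inj
    (trans (≡-sym (vertex-∷ʳ-inject₁ π e i′)) (trans q (vertex-∷ʳ-inject₁ π e j′))))

  -- Two edges or more mean at least three vertices, so the closing edge makes the path a cycle in
  -- the sense of `IsCycle`.
  acyclic⇒¬closed : ∀ {a b l} → Acyclic G → (π : Path G a b (suc (suc l))) → Simple π → ¬ Adj G b a
  acyclic⇒¬closed {a} acy π inj ba =
    acy _ (vertex π) (inj , vertex-adj π , subst (λ x → Adj G x a) (≡-sym (vertex-last π)) ba)

least : {P : ℕ → Set} → Decidable P → ∀ {l} → P l → ∃ λ k → P k × (∀ {j} → P j → k ≤ j)
least {P} P? {zero}  p = zero , p , λ _ → z≤n
least {P} P? {suc l} p with P? zero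
... | yes p0 = zero , p0 , λ _ → z≤n
... | no ¬p0 with least (P? ∘ suc) p
...   | k , pk , min = suc k , pk , λ { {zero} p0 → contradiction p0 ¬p0 ; {suc j} pj → s≤s (min pj) }

module _ {m : ℕ} (T : Graph (suc m)) (isT : IsTree T) where

  private
    r : Fin (suc m)
    r = zero

  -- A walk of length exactly `l` to the root; recursion on `l` makes it decidable, and the least
  -- such `l` is the distance.
  Reach : ℕ → Fin (suc m) → Set
  Reach zero    i = i ≡ r
  Reach (suc l) i = ∃ λ j → Adj T i j × Reach l j

  reach? : ∀ i l → Dec (Reach l i)
  reach? i zero    = i Fin.≟ r
  reach? i (suc l) = Fin.any? λ j → (adj T i j ≟ᵇ true) ×-dec reach? j l

  walk⇒reach : ∀ {i} → Walk T (λ _ → ⊤) i r → ∃ λ l → Reach l i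
  walk⇒reach (here _)     = zero , refl
  walk⇒reach (step _ a w) with walk⇒reach w
  ... | l , q = suc l , _ , a , q

  distance : ∀ i → ∃ λ k → Reach k i × (∀ {j} → Reach j i → k ≤ j)
  distance i = least (reach? i) (proj₂ (walk⇒reach (proj₁ isT i r)))

  dist : Fin (suc m) → ℕ
  dist i = proj₁ (distance i)

  dist-adj : ∀ {i j} → Adj T i j → dist i ≤ suc (dist j)
  dist-adj {i} {j} a = proj₂ (proj₂ (distance i)) (j , a , proj₁ (proj₂ (distance j)))

  dist≡0⇒root : ∀ {i} → dist i ≡ 0 → i ≡ r
  dist≡0⇒root {i} e = subst (λ k → Reach k i) e (proj₁ (proj₂ (distance i)))

  descend : ∀ {i k} → dist i ≡ suc k → ∃ λ j → Adj T i j × dist j ≡ k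
  descend {i} {k} e with subst (λ k → Reach k i) e (proj₁ (proj₂ (distance i)))
  ... | j , a , q = j , a , ℕ.≤-antisym (proj₂ (proj₂ (distance j)) q)
    (s≤s⁻¹ (subst (_≤ suc (dist j)) e (dist-adj a)))

  -- Otherwise following the descents of both ends until they meet would close a cycle.
  no-level-path : ∀ e {a b l} (π : Path T a b (suc l)) → Simple π →
    (∀ i → e ≤ dist (vertex π i)) → dist a ≡ e → dist b ≡ e → ⊥
  no-level-path zero {l = l} π inj above da db
    with inj {zero} {fromℕ (suc l)} (trans (dist≡0⇒root da) (≡-sym (trans (vertex-last π) (dist≡0⇒root db))))
  ... | ()
  no-level-path (suc e) π inj above da db with descend da | descend db
  ... | a′ , aa′ , da′ | b′ , bb′ , db′ with a′ Fin.≟ b′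
  ...   | yes refl = acyclic⇒¬closed (proj₂ isT) (Adj-sym T aa′ ∷ π)
                       (∷-simple _ inj (fresh da′)) bb′
    where
    -- The path stays at distance at least `suc e`, so it misses every vertex at distance `e`.
    fresh : ∀ {x} → dist x ≡ e → ∀ i → vertex π i ≢ x
    fresh dx i q = ℕ.<-irrefl (≡-sym (trans (cong dist q) dx)) (above i)
  ...   | no a′≢b′ = no-level-path e (Adj-sym T aa′ ∷ (π ∷ʳ bb′))
                       (∷-simple _ (∷ʳ-simple bb′ inj (fresh db′)) fresh′) above′ da′ db′
    where
    fresh : ∀ {x} → dist x ≡ e → ∀ i → vertex π i ≢ x
    fresh dx i q = ℕ.<-irrefl (≡-sym (trans (cong dist q) dx)) (above i)
    fresh′ : ∀ i → vertex (π ∷ʳ bb′) i ≢ a′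
    fresh′ i q with view i
    ... | ‵fromℕ      = a′≢b′ (trans (≡-sym q) (vertex-last (π ∷ʳ bb′)))
    ... | ‵inject₁ i′ = fresh da′ i′ (trans (≡-sym (vertex-∷ʳ-inject₁ π bb′ i′)) q)
    above′ : ∀ i → e ≤ dist (vertex (Adj-sym T aa′ ∷ (π ∷ʳ bb′)) i)
    above′ zero = ℕ.≤-reflexive (≡-sym da′)
    above′ (suc i) with view i
    ... | ‵fromℕ      = ℕ.≤-reflexive (≡-sym (trans (cong dist (vertex-last (π ∷ʳ bb′))) db′))
    ... | ‵inject₁ i′ = ℕ.≤-trans (ℕ.n≤1+n e)
      (subst (λ x → suc e ≤ dist x) (≡-sym (vertex-∷ʳ-inject₁ π bb′ i′)) (above i′))

  towardsRoot : ∀ i → ∃ λ j → i ≢ r → Adj T i j × dist i ≡ suc (dist j)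
  towardsRoot i = go (dist i) refl
    where
    go : ∀ k → dist i ≡ k → ∃ λ j → i ≢ r → Adj T i j × dist i ≡ suc (dist j)
    -- The root is sent to itself as a default; keeping `i ≢ r` inside the existential makes the
    -- parent a total function.
    go zero    e = i , λ i≢ → contradiction (dist≡0⇒root e) i≢
    go (suc k) e with descend e
    ... | j , a , q = j , λ _ → a , trans e (cong suc (≡-sym q))

  treeRooting : Rooting (suc m)
  treeRooting = record
    { root         = r
    ; parent       = λ i → proj₁ (towardsRoot i)
    ; depth        = dist
    ; depth-parent = λ {s} s≢ → ℕ.≤-reflexive (≡-sym (proj₂ (proj₂ (towardsRoot s) s≢)))
    }

  tree-same-level : ∀ {i j} → Adj T i j → dist i ≢ dist j
  tree-same-level {i} {j} a e = no-level-path (dist i) (a ∷ [ j ])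
    (∷-simple a {[ j ]} (λ { {zero} {zero} _ → refl }) λ { zero q → Adj⇒≢ T a (≡-sym q) })
    (λ { zero → ℕ.≤-refl ; (suc zero) → ℕ.≤-reflexive e }) refl (≡-sym e)

  tree-lower : ∀ {i j} → Adj T i j → dist i < dist j → ParentOf treeRooting i j
  tree-lower {i} {j} a i<j with j Fin.≟ r
  ... | yes refl = contradiction i<j
    (ℕ.≤⇒≯ (ℕ.≤-trans (proj₂ (proj₂ (distance r)) {0} refl) z≤n))
  ... | no j≢ with proj₁ (towardsRoot j) | proj₂ (towardsRoot j) j≢
  ...   | p | jp , dj with p Fin.≟ i
  ...     | yes e = j≢ , e
  -- A second neighbour `p` of `j` on the level of `i` would make `i`, `j`, `p` a path with both
  -- ends on that level and nothing closer to the root.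
  ...     | no p≢i = ⊥-elim (no-level-path (dist i) (a ∷ (jp ∷ [ p ])) simple above refl dp)
    where
    dp : dist p ≡ dist i
    dp = ℕ.≤-antisym
      (s≤s⁻¹ (subst (_≤ suc (dist i)) dj (dist-adj (Adj-sym T a))))
      (s≤s⁻¹ (subst (dist i <_) dj i<j))
    simple : Simple (a ∷ (jp ∷ [ p ]))
    simple = ∷-simple a (∷-simple jp {[ p ]} (λ { {zero} {zero} _ → refl }) λ { zero q → Adj⇒≢ T jp (≡-sym q) })
      λ { zero q → Adj⇒≢ T a (≡-sym q) ; (suc zero) q → p≢i q }
    above : ∀ k → dist i ≤ dist (vertex (a ∷ (jp ∷ [ p ])) k)
    above zero             = ℕ.≤-refl
    above (suc zero)       = ℕ.<⇒≤ i<j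
    above (suc (suc zero)) = ℕ.≤-reflexive (≡-sym dp)

  tree-adj⇒parentOf : ∀ {i j} → Adj T i j → ParentOf treeRooting i j ⊎ ParentOf treeRooting j i
  tree-adj⇒parentOf {i} {j} a with ℕ.<-cmp (dist i) (dist j)
  ... | tri< i<j _ _ = inj₁ (tree-lower a i<j)
  ... | tri≈ _ e _   = contradiction e (tree-same-level a)
  ... | tri> _ _ j<i = inj₂ (tree-lower (Adj-sym T a) j<i)

-- Ancestors

module _ {N : ℕ} (R : Rooting N) where
  open Rooting R

  data Ancestor (x : Fin N) : Fin N → Set where
    self  : Ancestor x x
    above : ∀ {s} → s ≢ root → Ancestor x (parent s) → Ancestor x s

module AncestorProperties {N : ℕ} (R : Rooting N) where
  open Rooting R public

  infix 4 _≼_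
  _≼_ : Fin N → Fin N → Set
  x ≼ s = Ancestor R x s

  ≼-trans : ∀ {x y z} → x ≼ y → y ≼ z → x ≼ z
  ≼-trans p self         = p
  ≼-trans p (above z≢ q) = above z≢ (≼-trans p q)

  ≼⇒depth : ∀ {x s} → x ≼ s → depth x ≤ depth s
  ≼⇒depth self         = ℕ.≤-refl
  ≼⇒depth (above s≢ q) = ℕ.≤-trans (≼⇒depth q) (ℕ.<⇒≤ (depth-parent s≢))

  ≼-antisym : ∀ {x y} → x ≼ y → y ≼ x → x ≡ y
  ≼-antisym self         q = refl
  ≼-antisym (above y≢ p) q = contradiction (depth-parent y≢) (ℕ.≤⇒≯ (ℕ.≤-trans (≼⇒depth q) (≼⇒depth p)))

  root≼ : ∀ s → root ≼ s
  root≼ = climb _ self above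

  parent≼ : ∀ {s} → s ≢ root → parent s ≼ s
  parent≼ s≢ = above s≢ self

  ancestors-comparable : ∀ {x y s} → x ≼ s → y ≼ s → x ≼ y ⊎ y ≼ x
  ancestors-comparable self        q           = inj₂ q
  ancestors-comparable p           self        = inj₁ p
  ancestors-comparable (above _ p) (above _ q) = ancestors-comparable p q

  ≼⇒≡⊎child≼ : ∀ {x s} → x ≼ s → x ≡ s ⊎ ∃ λ c → c ≢ root × parent c ≡ x × c ≼ s
  ≼⇒≡⊎child≼ self = inj₁ refl
  ≼⇒≡⊎child≼ (above s≢ p) with ≼⇒≡⊎child≼ p
  ... | inj₁ refl              = inj₂ (_ , s≢ , refl , self)
  ... | inj₂ (c , c≢ , e , c≼) = inj₂ (c , c≢ , e , ≼-trans c≼ (parent≼ s≢))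

  -- The ancestors of `s` form a chain. If one sibling were strictly above the other, it would be an
  -- ancestor of the common parent, hence of its own parent.
  siblings-unique : ∀ {i j s} → i ≢ root → j ≢ root → parent i ≡ parent j → i ≼ s → j ≼ s → i ≡ j
  siblings-unique i≢ j≢ e i≼ j≼ with ancestors-comparable i≼ j≼
  ... | inj₁ self        = refl
  ... | inj₁ (above _ p) = contradiction (subst (λ x → _ ≼ x) (≡-sym e) p) λ q → ℕ.≤⇒≯ (≼⇒depth q) (depth-parent i≢)
  ... | inj₂ self        = refl
  ... | inj₂ (above _ p) = contradiction (subst (λ x → _ ≼ x) e p) λ q → ℕ.≤⇒≯ (≼⇒depth q) (depth-parent j≢)

  data Meet (a b : Fin N) : Set where
    upper : a ≼ b → Meet a b
    lower : b ≼ a → Meet a b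
    fork  : ∀ i j → i ≢ root → j ≢ root → parent i ≡ parent j → i ≢ j → i ≼ a → j ≼ b → Meet a b

  meet : ∀ a b → Meet a b
  meet a b = climb (λ a → Meet a b) (upper (root≼ b)) up a
    where
    up : ∀ {a} → a ≢ root → Meet (parent a) b → Meet a b
    up {a} a≢ (lower q) = lower (≼-trans q (parent≼ a≢))
    up {a} a≢ (fork i j i≢ j≢ e i≢j i≼ j≼) = fork i j i≢ j≢ e i≢j (≼-trans i≼ (parent≼ a≢)) j≼
    -- The parent of `a` lies on the path to `b`; a fork arises exactly when that path continues
    -- through a child other than `a`.
    up {a} a≢ (upper q) with ≼⇒≡⊎child≼ q
    ... | inj₁ e = lower (subst (λ x → x ≼ a) e (parent≼ a≢))
    ... | inj₂ (j , j≢ , e , j≼) with a Fin.≟ j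
    ...   | yes refl = upper j≼
    ...   | no a≢j   = fork a j a≢ j≢ (≡-sym e) a≢j self j≼

-- Rooted tree decompositions

-- Connectedness of the nodes whose bags contain `v` is encoded by `top` and `∈parent`: each of them
-- other than `top v` has its parent among them, so all of them climb to `top v`.
record RootedDecomposition {n} (G : Graph n) : Set where
  field
    {size}       : ℕ
    rooting      : Rooting (suc size)
    bagAt        : Fin (suc size) → Subset n
    top          : Fin n → Fin (suc size)
    ∈top         : ∀ v → v ∈ bagAt (top v)
    edge-covered : ∀ a b → Adj G a b → ∃ λ t → (a ∈ bagAt t × b ∈ bagAt t)

  open Rooting rooting

  field
    ∈parent : ∀ {v s} → v ∈ bagAt s → s ≢ top v → s ≢ root × v ∈ bagAt (parent s)

  climb-to-top : ∀ v (P : Fin (suc size) → Set) → P (top v) →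
    (∀ {s} → s ≢ root → v ∈ bagAt s → P (parent s) → P s) → ∀ s → v ∈ bagAt s → P s
  climb-to-top v P base up = climb (λ s → v ∈ bagAt s → P s) at-root at-node
    where
    at-root : v ∈ bagAt root → P root
    at-root v∈ with root Fin.≟ top v
    ... | yes e = subst P (≡-sym e) base
    ... | no r≢ = contradiction refl (proj₁ (∈parent v∈ r≢))
    at-node : ∀ {s} → s ≢ root → (v ∈ bagAt (parent s) → P (parent s)) → v ∈ bagAt s → P s
    at-node {s} s≢ rec v∈ with s Fin.≟ top v
    ... | yes e  = subst P (≡-sym e) base
    ... | no s≢t = up s≢ v∈ (rec (proj₂ (∈parent v∈ s≢t)))

unrooted : ∀ {n} {G : Graph n} → RootedDecomposition G → TreeDecomposition G
unrooted {n} {G} D = record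
  { m       = size
  ; T       = rootedGraph rooting
  ; isTree  = rooted-connected rooting , rooted-acyclic rooting
  ; bag     = bagAt
  ; coverV  = λ v → top v , ∈top v
  ; coverE  = edge-covered
  ; subtree = λ v s t v∈s v∈t → walk-to-top v s v∈s ++ʷ reverseʷ (walk-to-top v t v∈t)
  }
  where
  open RootedDecomposition D
  walk-to-top : ∀ v s → v ∈ bagAt s → Walk (rootedGraph rooting) (λ x → v ∈ bagAt x) s (top v)
  walk-to-top v = climb-to-top v _ (here (∈top v)) λ s≢ v∈ w → step v∈ (adj-parent rooting s≢) w

rooted : ∀ {n} {G : Graph n} → TreeDecomposition G → RootedDecomposition G
rooted {n} {G} D = record
  { rooting      = R
  ; bagAt        = bag D
  ; top          = λ v → proj₁ (highest v)
  ; ∈top         = λ v → proj₁ (proj₂ (highest v))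
  ; edge-covered = coverE D
  ; ∈parent      = ∈parent
  }
  where
  R = treeRooting (T D) (isTree D)
  open AncestorProperties R

  -- The only tree edge leaving the set of descendants of `s` joins `s` to its parent.
  leaves-downset : ∀ {P s x y} → Walk (T D) P x y → s ≼ x → s ≼ y ⊎ (s ≢ root × P (parent s))
  leaves-downset (here _) s≼ = inj₁ s≼
  leaves-downset (step {j = z} _ a w) s≼ with tree-adj⇒parentOf (T D) (isTree D) a
  ... | inj₁ (z≢ , refl) = leaves-downset w (above z≢ s≼)
  ... | inj₂ (x≢ , refl) with s≼
  ...   | self       = inj₂ (x≢ , walk-start w)
  ...   | above _ s≼z = leaves-downset w s≼z

  Highest : Fin n → Fin (suc (m D)) → Set
  Highest v t = v ∈ bag D t × ¬ (t ≢ root × v ∈ bag D (parent t))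

  highest-above : ∀ v s → v ∈ bag D s → ∃ (Highest v)
  highest-above v = climb (λ s → v ∈ bag D s → ∃ (Highest v)) (λ v∈ → root , v∈ , λ q → proj₁ q refl) up
    where
    up : ∀ {s} → s ≢ root → (v ∈ bag D (parent s) → ∃ (Highest v)) → v ∈ bag D s → ∃ (Highest v)
    up {s} s≢ rec v∈ with v ∈? bag D (parent s)
    ... | yes v∈p = rec v∈p
    ... | no v∉p  = s , v∈ , λ q → v∉p (proj₂ q)

  highest : ∀ v → ∃ (Highest v)
  highest v = highest-above v _ (proj₂ (coverV D v))

  ∈parent : ∀ {v s} → v ∈ bag D s → s ≢ proj₁ (highest v) → s ≢ root × v ∈ bag D (parent s)
  ∈parent {v} {s} v∈s s≢ with highest v
  -- The walk from `t` to `s` cannot leave the descendants of `t`, so `t` is above `s`. The reverse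
  -- walk then has to pass through the parent of `s`, since otherwise `s` and `t` coincide.
  ... | t , v∈t , stop with leaves-downset (subtree D v t s v∈t v∈s) self
  ...   | inj₂ q = contradiction q stop
  ...   | inj₁ t≼s with leaves-downset (subtree D v s t v∈s v∈t) self
  ...     | inj₂ q   = q
  ...     | inj₁ s≼t = contradiction (≼-antisym s≼t t≼s) s≢

-- Cardinalities of subsets

comprehension : ∀ {n} {P : Fin n → Set} → Decidable P → Subset n
comprehension P? = tabulate (does ∘ P?)

∈-comprehension⁺ : ∀ {n} {P : Fin n → Set} (P? : Decidable P) {v} → P v → v ∈ comprehension P?
∈-comprehension⁺ P? {v} p = lookup⇒[]= v _ (trans (lookup∘tabulate _ v) (dec-true (P? v) p))

∈-comprehension⁻ : ∀ {n} {P : Fin n → Set} (P? : Decidable P) {v} → v ∈ comprehension P? → P v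
∈-comprehension⁻ P? {v} v∈ with P? v | trans (≡-sym (lookup∘tabulate (does ∘ P?) v)) ([]=⇒lookup v∈)
... | yes p | _ = p
... | no _  | ()

∣p∪q∣≤∣p∣+∣q∣ : ∀ {n} (p q : Subset n) → ∣ p ∪ q ∣ ≤ ∣ p ∣ + ∣ q ∣
∣p∪q∣≤∣p∣+∣q∣ []            []            = z≤n
∣p∪q∣≤∣p∣+∣q∣ (outside ∷ p) (outside ∷ q) = ∣p∪q∣≤∣p∣+∣q∣ p q
∣p∪q∣≤∣p∣+∣q∣ (outside ∷ p) (inside ∷ q)  =
  ℕ.≤-trans (s≤s (∣p∪q∣≤∣p∣+∣q∣ p q)) (ℕ.≤-reflexive (≡-sym (ℕ.+-suc ∣ p ∣ ∣ q ∣)))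
∣p∪q∣≤∣p∣+∣q∣ (inside ∷ p)  (outside ∷ q) = s≤s (∣p∪q∣≤∣p∣+∣q∣ p q)
∣p∪q∣≤∣p∣+∣q∣ (inside ∷ p)  (inside ∷ q)  =
  s≤s (ℕ.≤-trans (∣p∪q∣≤∣p∣+∣q∣ p q) (ℕ.+-monoʳ-≤ ∣ p ∣ (ℕ.n≤1+n ∣ q ∣)))

-- Choosing one lift per vertex is injective. The lifts of a vertex occupy two consecutive positions
-- of `q`, so the induction removes two entries of `q` for each entry of `p`.
∣section∣≤ : ∀ {n} (p : Subset n) (q : Subset (n * 2)) (σ : Fin n → Fin 2) →
  (∀ v → v ∈ p → combine v (σ v) ∈ q) → ∣ p ∣ ≤ ∣ q ∣
∣section∣≤ [] [] σ f = z≤n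
∣section∣≤ (s ∷ p) (x ∷ y ∷ q) σ f
  with ∣section∣≤ p q (σ ∘ suc) (λ v v∈ → drop-there (drop-there (f (suc v) (there v∈))))
∣section∣≤ (outside ∷ p) (x ∷ y ∷ q) σ f | ih = ℕ.≤-trans ih (ℕ.≤-trans (∣p∣≤∣x∷p∣ y q) (∣p∣≤∣x∷p∣ x (y ∷ q)))
∣section∣≤ (inside ∷ p) (x ∷ y ∷ q) σ f | ih with σ zero | f zero here
... | zero     | here       = s≤s (ℕ.≤-trans ih (∣p∣≤∣x∷p∣ y q))
... | suc zero | there here = ℕ.≤-trans (s≤s ih) (∣p∣≤∣x∷p∣ x (inside ∷ q))

-- Projecting a decomposition of the double cover

×K₂-adj : ∀ {n} (G : Graph n) {u v} → Adj G u v → ∀ a → Adj (G ×K₂) (combine u a) (combine v (opposite a))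
×K₂-adj G {u} {v} e a = subst₂
  (λ x y → adj G (proj₁ x) (proj₁ y) ∧ k2adj (proj₂ x) (proj₂ y) ≡ true)
  (≡-sym (Fin.remQuot-combine u a)) (≡-sym (Fin.remQuot-combine v (opposite a)))
  (cong₂ _∧_ e (flips a))
  where
  flips : ∀ a → k2adj a (opposite a) ≡ true
  flips zero       = refl
  flips (suc zero) = refl

-- The nodes (y, z) form a copy of the tree indexed by y, with a further copy,
-- indexed by z, hung below each y by identifying its root (y, root) with y.
module _ {N : ℕ} (R : Rooting N) where
  open Rooting R

  combParent : Fin N × Fin N → Fin N × Fin N
  combParent (y , z) with z Fin.≟ root
  ... | yes _ = parent y , root
  ... | no _  = y , parent z

  combDepth : Fin N × Fin N → ℕ
  combDepth (y , z) = depth y + depth z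

  combDepth-parent : ∀ x → x ≢ (root , root) → combDepth (combParent x) < combDepth x
  combDepth-parent (y , z) x≢ with z Fin.≟ root
  ... | yes refl = ℕ.+-monoˡ-< (depth root) (depth-parent λ { refl → x≢ refl })
  ... | no z≢    = ℕ.+-monoʳ-< (depth y) (depth-parent z≢)

  comb : Rooting (N * N)
  comb = record
    { root         = combine root root
    ; parent       = λ s → combine (proj₁ (combParent (remQuot N s))) (proj₂ (combParent (remQuot N s)))
    ; depth        = λ s → combDepth (remQuot N s)
    ; depth-parent = λ {s} s≢ → subst (λ x → combDepth x < combDepth (remQuot N s))
        (≡-sym (Fin.remQuot-combine _ _))
        (combDepth-parent (remQuot N s) λ e → s≢ (trans (≡-sym (Fin.combine-remQuot {N} N s))
          (cong₂ combine (cong proj₁ e) (cong proj₂ e))))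
    }

smaller : ∀ {N} → (Fin 2 → Fin N) → Fin 2
smaller c with c zero Fin.<? c (suc zero)
... | yes _ = zero
... | no _  = suc zero

-- Both functions list the same two nodes in opposite orders, so the smaller node has opposite
-- indices in them.
smaller-swap : ∀ {N} {c c′ : Fin 2 → Fin N} → c zero ≢ c (suc zero) →
  (∀ a → c a ≡ c′ (opposite a)) → smaller c′ ≡ opposite (smaller c)
smaller-swap {c = c} {c′} c≢ swap
  with c zero Fin.<? c (suc zero) | c′ zero Fin.<? c′ (suc zero)
... | yes _   | no _    = refl
... | no _    | yes _   = refl
... | yes c<  | yes c′< = contradiction
  (subst₂ _<ᶠ_ (≡-sym (swap (suc zero))) (≡-sym (swap zero)) c′<) (Fin.<-asym c<)
... | no c≮   | no c′≮  with Fin.<-cmp (c zero) (c (suc zero))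
...   | tri< c< _ _ = contradiction c< c≮
...   | tri≈ _ e _  = contradiction e c≢
...   | tri> _ _ c> = contradiction (subst₂ _<ᶠ_ (swap (suc zero)) (swap zero) c>) c′≮

module Projection {n : ℕ} (G : Graph n) (D : RootedDecomposition (G ×K₂)) where
  open RootedDecomposition D
  open AncestorProperties rooting

  Node : Set
  Node = Fin (suc size)

  top≼ : ∀ {v} s → v ∈ bagAt s → top v ≼ s
  top≼ {v} = climb-to-top v (top v ≼_) self λ s≢ _ → above s≢

  -- Climbing from `s`, the vertex `v` stays in the bags until `top v`, which is not passed before
  -- `x` is reached.
  ∈between : ∀ {v x s} → top v ≼ x → x ≼ s → v ∈ bagAt s → v ∈ bagAt x
  ∈between t≼x self v∈ = v∈
  ∈between {v} {x} {s} t≼x (above s≢ x≼p) v∈ with s Fin.≟ top v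
  ... | yes refl = contradiction (depth-parent s≢) (ℕ.≤⇒≯ (≼⇒depth (≼-trans t≼x x≼p)))
  ... | no s≢t   = ∈between t≼x x≼p (proj₂ (∈parent v∈ s≢t))

  τ : Fin n → Fin 2 → Node
  τ v a = top (combine v a)

  data Position (v : Fin n) : Set where
    anchored : ∀ a → (∀ b → τ v a ≼ τ v b) → Position v
    forked   : (c : Fin 2 → Node) → (∀ a → c a ≢ root) → (∀ a b → parent (c a) ≡ parent (c b)) →
               c zero ≢ c (suc zero) → (∀ a → c a ≼ τ v a) → Position v

  position : ∀ v → Position v
  position v with meet (τ v zero) (τ v (suc zero))
  ... | upper p = anchored zero λ { zero → self ; (suc zero) → p }
  ... | lower p = anchored (suc zero) λ { zero → p ; (suc zero) → self }
  ... | fork i j i≢ j≢ e i≢j i≼ j≼ = forked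
    (λ { zero → i ; (suc zero) → j })
    (λ { zero → i≢ ; (suc zero) → j≢ })
    (λ { zero zero → refl ; zero (suc zero) → e ; (suc zero) zero → ≡-sym e ; (suc zero) (suc zero) → refl })
    i≢j
    (λ { zero → i≼ ; (suc zero) → j≼ })

  -- Comparing the children c zero and c (suc zero) gives adjacent vertices forked
  -- at the same node opposite sides, so that their chosen lifts are adjacent.
  side : ∀ {v} → Position v → Fin 2
  side (anchored a _)       = a
  side (forked c _ _ _ _)   = smaller c

  place : ∀ {v} → Position v → Node
  place {v} (anchored a _)  = τ v a
  place (forked c _ _ _ _)  = parent (c zero)

  place≼τ : ∀ {v} (p : Position v) a → place p ≼ τ v a
  place≼τ (anchored _ min)          b = min b
  place≼τ (forked c c≢ sib _ c≼) b = subst (_≼ _) (sib b zero) (≼-trans (parent≼ (c≢ b)) (c≼ b))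

  Member : ∀ {v} → Position v → Node × Node → Set
  Member {v} (anchored a _)         (y , z) = combine v a ∈ bagAt y
  Member {v} (forked c _ _ _ _)     (y , z) = parent (c zero) ≡ y × combine v (smaller c) ∈ bagAt z

  member? : ∀ x {v} (p : Position v) → Dec (Member p x)
  member? (y , z) (anchored a _)       = _ ∈? bagAt y
  member? (y , z) (forked c _ _ _ _)   = (parent (c zero) Fin.≟ y) ×-dec (_ ∈? bagAt z)

  member-∈ : ∀ {v y z} (p : Position v) → Member p (y , z) → combine v (side p) ∈ bagAt y ∪ bagAt z
  member-∈ (anchored _ _)     v∈       = x∈p∪q⁺ (inj₁ v∈)
  member-∈ (forked _ _ _ _ _) (_ , v∈) = x∈p∪q⁺ (inj₂ v∈)

  -- The top of the subtree of `v` in the comb: in the copy with second coordinate `root` for an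
  -- anchored vertex, in the copy hung at its fork for a forked one.
  apex : ∀ {v} → Position v → Node × Node
  apex p@(anchored _ _)             = place p , root
  apex {v} p@(forked _ _ _ _ _)     = place p , τ v (side p)

  member-apex : ∀ {v} (p : Position v) → Member p (apex p)
  member-apex (anchored _ _)     = ∈top _
  member-apex (forked _ _ _ _ _) = refl , ∈top _

  member-parent : ∀ {v} (p : Position v) x → Member p x → x ≢ apex p →
    x ≢ (root , root) × Member p (combParent rooting x)
  member-parent (anchored a _) (y , z) v∈ x≢ with z Fin.≟ root
  -- Membership of an anchored vertex ignores `z`, so it survives every step inside a hung copy.
  ... | no z≢    = (λ { refl → z≢ refl }) , v∈
  ... | yes refl with ∈parent v∈ (λ { refl → x≢ refl })
  ...   | y≢ , v∈p = (λ { refl → y≢ refl }) , v∈p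
  -- Below its top the lift cannot sit at the root, so the climb never leaves the copy hung at the
  -- fork.
  member-parent (forked _ _ _ _ _) (y , z) (refl , v∈) x≢ with ∈parent v∈ (λ { refl → x≢ refl })
  ... | z≢ , v∈p with z Fin.≟ root
  ...   | yes z≡ = contradiction z≡ z≢
  ...   | no _   = (λ { refl → z≢ refl }) , refl , v∈p

  shared : ∀ {u v} → Adj G u v → ∀ a →
    ∃ λ s → combine u a ∈ bagAt s × combine v (opposite a) ∈ bagAt s
  shared e a = edge-covered _ _ (×K₂-adj G e a)

  place≼ : ∀ {v s} (p : Position v) a → combine v a ∈ bagAt s → place p ≼ s
  place≼ p a v∈ = ≼-trans (place≼τ p a) (top≼ _ v∈)

  -- The lift of `u` shares a bag with the opposite lift of `v`, and that bag is below `place q`. As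
  -- `place q` is below the top of the lift of `u`, its bag contains that lift.
  member-anchored : ∀ {u v} → Adj G u v → ∀ a min (q : Position v) →
    τ u a ≼ place q → Member {u} (anchored a min) (apex q)
  member-anchored e a min q τ≼ with shared e a
  ... | s , u∈ , v∈ with ∈between τ≼ (place≼ q (opposite a) v∈) u∈
  -- Splitting on `q` only lets `apex q` compute; its first coordinate is `place q` in both cases.
  member-anchored e a min (anchored _ _)     τ≼ | s , u∈ , v∈ | u∈q = u∈q
  member-anchored e a min (forked _ _ _ _ _) τ≼ | s , u∈ , v∈ | u∈q = u∈q

  -- Both lifts of u share bags with lifts of v and hence with nodes below place q,
  -- but a node strictly below a fork lies under at most one of its two children.
  forked-highest : ∀ {u v} → Adj G u v → ∀ {c c≢ sib c≢c c≼} (q : Position v) →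
    place {u} (forked c c≢ sib c≢c c≼) ≼ place q → parent (c zero) ≡ place q
  forked-highest e {c} {c≢} {sib} {c≢c} {c≼} q p≼q with ≼⇒≡⊎child≼ p≼q
  ... | inj₁ p≡q = p≡q
  ... | inj₂ (l , l≢ , l-child , l≼) = contradiction (trans (≡-sym (l≡c zero)) (l≡c (suc zero))) c≢c
    where
    l≡c : ∀ a → l ≡ c a
    l≡c a with shared e a
    ... | s , u∈ , v∈ = siblings-unique l≢ (c≢ a) (trans l-child (sib zero a))
      (≼-trans l≼ (place≼ q (opposite a) v∈)) (≼-trans (c≼ a) (top≼ s u∈))

  CommonBag : ∀ {u v} → Position u → Position v → Set
  CommonBag p q = ∃ λ x → Member p x × Member q x

  common-bag-≼ : ∀ {u v} → Adj G u v → (p : Position u) (q : Position v) → place p ≼ place q → CommonBag p q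
  common-bag-≼ e (anchored a min) q p≼q = apex q , member-anchored e a min q p≼q , member-apex q
  common-bag-≼ e (forked c c≢ sib c≢c c≼) q p≼q with forked-highest e {c} {c≢} {sib} {c≢c} {c≼} q p≼q
  -- The two places coincide, so the roles can be exchanged and the anchored vertex found at the
  -- apex of the forked one.
  common-bag-≼ e p@(forked _ _ _ _ _) (anchored a min) p≼q | p≡q =
    apex p , member-apex p , member-anchored (Adj-sym G e) a min p (subst (_≼ place p) p≡q self)
  common-bag-≼ {u} {v} e (forked c c≢ sib c≢c c≼) (forked c′ c′≢ sib′ _ c′≼) p≼q | p≡q
    with shared e (smaller c)
  ... | s , u∈ , v∈ = (parent (c zero) , s) , (refl , u∈) ,
        (≡-sym p≡q , subst (λ a → combine v a ∈ bagAt s) (≡-sym (smaller-swap {c = c} {c′} c≢c swap)) v∈)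
    where
    -- A bag shared by adjacent lifts lies below one child of the common fork, so lift `a` of `u`
    -- and the opposite lift of `v` use the same child.
    swap : ∀ a → c a ≡ c′ (opposite a)
    swap a with shared e a
    ... | s , u∈ , v∈ = siblings-unique (c≢ a) (c′≢ _)
      (trans (sib a zero) (trans p≡q (sib′ zero _)))
      (≼-trans (c≼ a) (top≼ s u∈)) (≼-trans (c′≼ _) (top≼ s v∈))

  -- Both places are ancestors of a node whose bag contains adjacent lifts of `u` and `v`, hence
  -- they are comparable.
  common-bag : ∀ {u v} → Adj G u v → (p : Position u) (q : Position v) → CommonBag p q
  common-bag e p q with shared e zero
  ... | s , u∈ , v∈ with ancestors-comparable (place≼ p zero u∈) (place≼ q (suc zero) v∈)
  ...   | inj₁ p≼q = common-bag-≼ e p q p≼q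
  ...   | inj₂ q≼p with common-bag-≼ (Adj-sym G e) q p q≼p
  ...     | x , v∈x , u∈x = x , u∈x , v∈x

  inBag? : ∀ x → Decidable (λ v → Member (position v) x)
  inBag? x v = member? x (position v)

  pairBag : Node × Node → Subset n
  pairBag x = comprehension (inBag? x)

  encode : Node × Node → Fin (suc size * suc size)
  encode (y , z) = combine y z

  decode : Fin (suc size * suc size) → Node × Node
  decode = remQuot (suc size)

  ∈encode : ∀ {v x} → Member (position v) x → v ∈ pairBag (decode (encode x))
  ∈encode {v} {x@(y , z)} v∈ = subst (λ w → v ∈ pairBag w) (≡-sym (Fin.remQuot-combine y z)) (∈-comprehension⁺ (inBag? x) v∈)

  projected : RootedDecomposition G
  projected = record
    { rooting      = comb rooting
    ; bagAt        = λ s → pairBag (decode s)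
    ; top          = λ v → encode (apex (position v))
    ; ∈top         = λ v → ∈encode (member-apex (position v))
    ; edge-covered = λ u v e → let x , u∈ , v∈ = common-bag e (position u) (position v)
                               in encode x , ∈encode u∈ , ∈encode v∈
    ; ∈parent      = λ {v} {s} v∈ s≢ →
        let x≢ , v∈p = member-parent (position v) (decode s) (∈-comprehension⁻ (inBag? (decode s)) v∈)
                         λ e → s≢ (trans (≡-sym (Fin.combine-remQuot {suc size} (suc size) s)) (cong encode e))
        in (λ e → x≢ (trans (cong decode e) (Fin.remQuot-combine root root))) , ∈encode v∈p
    }

  ∣projected∣≤ : ∀ {k} → (∀ x → ∣ bagAt x ∣ ≤ k) → ∀ s → ∣ RootedDecomposition.bagAt projected s ∣ ≤ k + k
  ∣projected∣≤ {k} bound s with decode s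
  ... | x@(y , z) = begin
    ∣ pairBag x ∣               ≤⟨ ∣section∣≤ (pairBag x) (bagAt y ∪ bagAt z) (λ v → side (position v))
                                     (λ v v∈ → member-∈ (position v) (∈-comprehension⁻ (inBag? x) v∈)) ⟩
    ∣ bagAt y ∪ bagAt z ∣       ≤⟨ ∣p∪q∣≤∣p∣+∣q∣ (bagAt y) (bagAt z) ⟩
    ∣ bagAt y ∣ + ∣ bagAt z ∣   ≤⟨ ℕ.+-mono-≤ (bound y) (bound z) ⟩
    k + k                       ∎
    where open ℕ.≤-Reasoning

-- If all bags of `D` had size at most `k`, the projected bags would have size at most `k + k`,
-- hence at most `t`, while `TwAtLeast G t` provides one of size `suc t`.
treewidth-of-×K₂ : ∀ {n} (G : Graph n) {k t} → k + k ≤ t → TwAtLeast G t → TwAtLeast (G ×K₂) k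
treewidth-of-×K₂ G {k} {t} 2k≤t tw D with Fin.any? (λ x → suc k ≤? ∣ bag D x ∣)
... | yes q = q
... | no ¬q with tw (unrooted (Projection.projected G (rooted D)))
...   | x , t<∣x∣ = contradiction
  (ℕ.≤-trans (Projection.∣projected∣≤ G (rooted D) (λ y → ℕ.≮⇒≥ λ k< → ¬q (y , k<)) x) 2k≤t)
  (ℕ.<⇒≱ t<∣x∣)

-- Arithmetic of the bound

square-cancel-≤ : ∀ {a b} → a * a ≤ b * b → a ≤ b
square-cancel-≤ a²≤b² = ℕ.≮⇒≥ λ b<a → ℕ.≤⇒≯ a²≤b² (ℕ.*-mono-< b<a b<a)

[k+k]²≤4k⁸log⁵ : ∀ k → k ≥ 2 → (k + k) * (k + k) ≤ 4 * (k ^ 8) * (⌊log₂ k ⌋ ^ 5)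
[k+k]²≤4k⁸log⁵ k 2≤k = begin
  (k + k) * (k + k)                  ≡⟨ double-square k ⟩
  4 * (k ^ 2)                        ≤⟨ ℕ.*-monoʳ-≤ 4 (ℕ.^-monoʳ-≤ k {2} {8} (s≤s (s≤s z≤n))) ⟩
  4 * (k ^ 8)                        ≤⟨ ℕ.m≤m*n (4 * (k ^ 8)) (⌊log₂ k ⌋ ^ 5) ⟩
  4 * (k ^ 8) * (⌊log₂ k ⌋ ^ 5)      ∎
  where
  open ℕ.≤-Reasoning
  double-square : ∀ k → (k + k) * (k + k) ≡ 4 * (k * (k * 1))
  double-square = solve-∀
  instance
    k≢0 = >-nonZero (ℕ.≤-trans (s≤s z≤n) 2≤k)
    -- By computation `⌊log₂ 2 ⌋` is 1, so monotonicity makes the logarithm positive.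
    log≢0 = >-nonZero (⌊log₂⌋-mono-≤ 2≤k)
    log⁵≢0 = ℕ.m^n≢0 ⌊log₂ k ⌋ 5

theorem34 : Σ ℕ λ c → 1 ≤ c ×
    (∀ (k : ℕ) → k ≥ 2 → ∀ {n} (G : Graph n) (t : ℕ) →
    c * (k ^ 8) * (⌊log₂ k ⌋ ^ 5) ≤ t * t →
    TwAtLeast G t → TwAtLeast (G ×K₂) k)
-- The hypothesis on `t` is squared to avoid the half-integral exponent, so 4 is the square of the
-- factor 2 lost in the projection.
theorem34 = 4 , s≤s z≤n , λ k k≥2 G t t-large →
  treewidth-of-×K₂ G (square-cancel-≤ (ℕ.≤-trans ([k+k]²≤4k⁸log⁵ k k≥2) t-large))
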